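{- Let $E$ be an Archimedean sharply dominating effect algebra fulfilling the condition (W+). Then every element $x\in E$ is the sum of $\widetilde{x}$ and of the orthosum of a system of hypermeager elements; that is, there is an orthogonal system $G$ of hypermeager elements of $E$ whose orthosum $\bigoplus G$ exists and $x=\widetilde{x}\oplus\bigoplus G$.
   Context: An effect algebra is a partial algebra $(E;\oplus,0,1)$ with $0\neq 1$ and a partial binary operation $\oplus$ such that for all $x,y,z\in E$: (1) $x\oplus y=y\oplus x$ if $x\oplus y$ is defined; (2) $(x\oplus y)\oplus z=x\oplus(y\oplus z)$ if one side is defined; (3) for every $x$ there is a unique $y$ (denoted $x'$) with $x\oplus y=1$; (4) if $1\oplus x$ is defined then $x=0$. One writes $x\le y$ and $y\ominus x=z$ iff $x\oplus z$ is defined and equals $y$; $\le$ is a partial order. $E$ is Archimedean if for every nonzero $x\in E$ there is a greatest positive integer $n$ such that $nx=x\oplus\dots\oplus x$ ($n$ times) exists. A system $G=(x_\kappa)_{\kappa\in H}$ of not necessarily different elements of $E$ is orthogonal if for every finite subsystem $K$ of $G$ the sum $\bigoplus K$ exists (with $\bigoplus\emptyset=0$). Put $G^\oplus=\{\bigoplus K\mid K\subseteq G\text{ finite}\}$. The orthosum $\bigoplus G$ of an orthogonal system $G$ exists iff the supremum $\bigvee G^\oplus$ exists in $E$, and then $\bigoplus G=\bigvee G^\oplus$. $E$ fulfills the condition (W+) if for each orthogonal subset $A\subseteq E$ and each two upper bounds $u,v$ of $A^\oplus$ there exists an upper bound $w$ of $A^\oplus$ with $w\le u$ and $w\le v$.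 An element $x\in E$ is sharp if $x\wedge x'=0$; $\mathrm{S}(E)$ is the set of sharp elements. $E$ is sharply dominating if for every $x\in E$ there is a smallest sharp element $\widehat{x}$ above $x$; equivalently, for every $x\in E$ there is a greatest sharp element $\widetilde{x}$ below $x$. An element $x\in E$ is hypermeager if there is $y\in E$ with $x\le y$ and $x\le y'$. -}

module Defs where

open import Level using (Level; suc)
open import Data.List.Base using (List; []; _∷_; map; replicate)
open import Data.List.Relation.Unary.All using (All)
open import Data.List.Relation.Unary.Unique.Propositional using (Unique)
open import Data.Maybe using (Maybe; just; Is-just; _>>=_)
open import Data.Nat.Base as ℕ using (ℕ)
open import Data.Product using (_×_; ∃-syntax; Σ-syntax; ∃!; proj₁)
open import Relation.Binary.PropositionalEquality using (_≡_; _≢_)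
open import Relation.Unary using (Pred; _∈_)

-- The partial operation takes values in Maybe: x ⊕ y ≡ just z says that
-- x ⊕ y is defined and equals z.  Hence ⊕-comm and ⊕-assoc are strong
-- (Kleene) equalities: if one side is defined, so is the other, and they agree.
record EffectAlgebra (ℓ : Level) : Set (suc ℓ) where
  infixl 6 _⊕_
  field
    Carrier : Set ℓ
    _⊕_     : Carrier → Carrier → Maybe Carrier
    𝟘 𝟙     : Carrier
    𝟘≢𝟙     : 𝟘 ≢ 𝟙
    ⊕-comm  : ∀ x y → x ⊕ y ≡ y ⊕ x
    ⊕-assoc : ∀ x y z → (x ⊕ y >>= λ s → s ⊕ z) ≡ (y ⊕ z >>= λ t → x ⊕ t)
    ortho   : ∀ x → ∃! _≡_ λ y → x ⊕ y ≡ just 𝟙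
    𝟙⊕-zero : ∀ x → Is-just (𝟙 ⊕ x) → x ≡ 𝟘

module EffectAlgebraTheory {ℓ : Level} (E : EffectAlgebra ℓ) where
  open EffectAlgebra E

  infix 8 _′
  infix 4 _≤_

  _′ : Carrier → Carrier
  x ′ = proj₁ (ortho x)

  _≤_ : Carrier → Carrier → Set ℓ
  x ≤ y = ∃[ z ] x ⊕ z ≡ just y

  IsSmallest IsGreatest : Pred Carrier ℓ → Carrier → Set ℓ
  IsSmallest P m = P m × (∀ z → P z → m ≤ z)
  IsGreatest P m = P m × (∀ z → P z → z ≤ m)

  UpperBound : Pred Carrier ℓ → Pred Carrier ℓ
  UpperBound P u = ∀ z → P z → z ≤ u

  IsSupremum : Pred Carrier ℓ → Carrier → Set ℓ
  IsSupremum P = IsSmallest (UpperBound P)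

  IsMeet : Carrier → Carrier → Carrier → Set ℓ
  IsMeet x y = IsGreatest (λ z → z ≤ x × z ≤ y)

  ⨁ : List Carrier → Maybe Carrier
  ⨁ []       = just 𝟘
  ⨁ (x ∷ xs) = ⨁ xs >>= λ s → x ⊕ s

  multiple : ℕ → Carrier → Maybe Carrier
  multiple n x = ⨁ (replicate n x)

  Archimedean : Set ℓ
  Archimedean = ∀ x → x ≢ 𝟘 →
    ∃[ n ] 1 ℕ.≤ n × Is-just (multiple n x)
         × (∀ m → Is-just (multiple m x) → m ℕ.≤ n)

  -- A system (g κ) with κ ranging over H is a function g : H → Carrier.  Its
  -- finite subsystems are given by duplicate-free lists of indices, so that
  -- equal elements at different indices are counted separately.
  Orthogonal : {H : Set ℓ} → (H → Carrier) → Set ℓ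
  Orthogonal {H} g = ∀ (K : List H) → Unique K → Is-just (⨁ (map g K))

  FiniteSums : {H : Set ℓ} → (H → Carrier) → Pred Carrier ℓ
  FiniteSums {H} g s = Σ[ K ∈ List H ] Unique K × ⨁ (map g K) ≡ just s

  IsOrthosum : {H : Set ℓ} → (H → Carrier) → Carrier → Set ℓ
  IsOrthosum g = IsSupremum (FiniteSums g)

  -- The same notions for a subset A.  The finite subsets are duplicate-free
  -- lists of elements; indexing a system by Σ Carrier A instead would repeat
  -- an element once for each proof of its membership.
  OrthogonalSet : Pred Carrier ℓ → Set ℓ
  OrthogonalSet A = ∀ (K : List Carrier) → Unique K → All (_∈ A) K → Is-just (⨁ K)

  SetFiniteSums : Pred Carrier ℓ → Pred Carrier ℓ
  SetFiniteSums A s =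
    Σ[ K ∈ List Carrier ] Unique K × All (_∈ A) K × ⨁ K ≡ just s

  W+ : Set (suc ℓ)
  W+ = ∀ (A : Pred Carrier ℓ) → OrthogonalSet A →
       ∀ u v → UpperBound (SetFiniteSums A) u → UpperBound (SetFiniteSums A) v →
       ∃[ w ] UpperBound (SetFiniteSums A) w × w ≤ u × w ≤ v

  Sharp : Pred Carrier ℓ
  Sharp x = IsMeet x (x ′) 𝟘

  SharplyDominating : Set ℓ
  SharplyDominating = ∀ x → ∃[ s ] IsSmallest (λ z → Sharp z × x ≤ z) s

  -- IsGreatestSharpBelow x t says t = x̃.
  IsGreatestSharpBelow : Carrier → Carrier → Set ℓ
  IsGreatestSharpBelow x = IsGreatest (λ z → Sharp z × z ≤ x)

  Hypermeager : Pred Carrier ℓ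
  Hypermeager x = ∃[ y ] x ≤ y × x ≤ y ′

{-# OPTIONS --safe #-}
module Submission where

-- Let t be the greatest sharp element below x and x = t ⊕ y.  Sharp elements are
-- closed under ⊕, so no nonzero sharp element lies below y; hence every nonzero
-- z ≤ y fails z ∧ z′ = 0 and has a nonzero hypermeager element below it.  By
-- Zorn's lemma take a maximal set A of multiples n h of hypermeager elements h,
-- with all finite sums below y, such that no a ∈ A can be added once more to all
-- finite sums of A within y.  If a nonzero hypermeager h could be added to A,
-- so could n h for the largest possible n, and n h ∉ A: maximality is
-- contradicted.  By (W+), an upper bound u of the finite sums of A yields an upper
-- bound w ≤ u, y; a nonzero difference of y and w would leave such an h, so
-- y = w ≤ u.  Splitting each n h ∈ A into n copies of h gives the system.

open import Defs
open import Level using (Level)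
open import Axiom.ExcludedMiddle using (ExcludedMiddle)
open import Axiom.Extensionality.Propositional using (Extensionality)
open import Data.Bool.Base using (Bool; true; false)
open import Data.Empty using (⊥-elim)
open import Data.Fin.Base using (Fin)
open import Data.List.Base
  using (List; []; _∷_; [_]; _++_; map; concatMap; replicate; tabulate; deduplicate)
open import Data.List.Membership.Propositional using (_∈_)
open import Data.List.Membership.Propositional.Properties
  using (∈-∃++; ∈-map⁺; ∈-deduplicate⁺; ∈-concatMap⁺; ∈-tabulate⁺; ∈-tabulate⁻)
open import Data.List.Properties using (map-++; map-tabulate)
open import Data.List.Relation.Binary.Disjoint.Propositional using (Disjoint)
open import Data.List.Relation.Binary.Permutation.Propositional
  using (_↭_; refl; prep; swap; ↭⇒↭ₛ) renaming (trans to _⟨↭⟩_)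
open import Data.List.Relation.Binary.Permutation.Propositional.Properties
  using (shift; All-resp-↭; ∈-resp-↭) renaming (map⁺ to ↭-map⁺)
import Data.List.Relation.Binary.Permutation.Setoid.Properties as Permutationₛ
open import Data.List.Relation.Unary.All as All using (All; []; _∷_)
import Data.List.Relation.Unary.All.Properties as All
open import Data.List.Relation.Unary.AllPairs as AllPairs using ([]; _∷_)
import Data.List.Relation.Unary.AllPairs.Properties as AllPairs
open import Data.List.Relation.Unary.Any as Any using (here; there)
open import Data.List.Relation.Unary.Unique.Propositional using (Unique)
import Data.List.Relation.Unary.Unique.Propositional.Properties as Unique
import Data.List.Relation.Unary.Unique.DecPropositional.Properties as DecUnique
open import Data.Maybe using (Maybe; just; Is-just; _>>=_)
open import Data.Maybe.Properties using (just-injective)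
import Data.Maybe.Relation.Unary.Any as Maybe
open import Data.Nat.Base as ℕ using (ℕ; zero; suc)
import Data.Nat.Properties as ℕ
open import Data.Product using (_×_; _,_; ∃-syntax; Σ-syntax; proj₁; proj₂; uncurry)
open import Data.Sum.Base using (_⊎_; inj₁; inj₂)
open import Data.Unit.Base using (tt)
open import Function.Base using (id; _∘_)
open import Relation.Binary.Definitions using (DecidableEquality)
open import Relation.Binary.PropositionalEquality
  using (_≡_; _≢_; refl; sym; trans; cong; subst; setoid)
open import Relation.Nullary using (¬_; yes; no; does; contradiction)
open import Relation.Unary using (Pred)

-- Subsets under excluded middle.

-- Subsets are Boolean-valued: under excluded middle this loses nothing, and it
-- keeps unions of families of subsets in the same universe.

Subset : ∀ {ℓ} → Set ℓ → Set ℓ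
Subset X = X → Bool

record ⟦_⟧ {ℓ} {X : Set ℓ} (A : Subset X) (x : X) : Set ℓ where
  constructor mem
  field holds : A x ≡ true

infix 4 _⊆_

_⊆_ : ∀ {ℓ} {X : Set ℓ} → Subset X → Subset X → Set ℓ
A ⊆ B = ∀ {x} → ⟦ A ⟧ x → ⟦ B ⟧ x

⊆-antisym : (∀ {a b} → Extensionality a b) →
            ∀ {ℓ} {X : Set ℓ} {A B : Subset X} → A ⊆ B → B ⊆ A → A ≡ B
⊆-antisym ext {A = A} {B} A⊆B B⊆A = ext λ x →
  agree (A x) (B x) (⟦_⟧.holds ∘ A⊆B ∘ mem) (⟦_⟧.holds ∘ B⊆A ∘ mem)
  where
  agree : ∀ b c → (b ≡ true → c ≡ true) → (c ≡ true → b ≡ true) → b ≡ c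
  agree false false _ _ = refl
  agree true  true  _ _ = refl
  agree true  false f _ = sym (f refl)
  agree false true  _ g = g refl

module Comprehension (em : ∀ {a} → ExcludedMiddle a) {ℓ} {X : Set ℓ} where

  opaque
    comprehension : ∀ {p} → Pred X p → Subset X
    comprehension P x = does (em {P = P x})

    comprehension⁺ : ∀ {p} {P : Pred X p} {x} → P x → ⟦ comprehension P ⟧ x
    comprehension⁺ {P = P} {x} Px with em {P = P x} in eq
    ... | yes _  = mem (cong does eq)
    ... | no ¬Px = contradiction Px ¬Px

    comprehension⁻ : ∀ {p} {P : Pred X p} {x} → ⟦ comprehension P ⟧ x → P x
    comprehension⁻ {P = P} {x} (mem eq) with em {P = P x}
    comprehension⁻ (mem _)  | yes Px = Px
    comprehension⁻ (mem ()) | no _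

  ⋃ : Subset (Subset X) → Subset X
  ⋃ C = comprehension λ x → ∃[ A ] ⟦ C ⟧ A × ⟦ A ⟧ x

  ⋃-upper : ∀ {C A} → ⟦ C ⟧ A → A ⊆ ⋃ C
  ⋃-upper A∈C x∈A = comprehension⁺ (_ , A∈C , x∈A)

  ⋃-least : ∀ {C B} → (∀ {A} → ⟦ C ⟧ A → A ⊆ B) → ⋃ C ⊆ B
  ⋃-least bound x∈⋃ with comprehension⁻ x∈⋃
  ... | _ , A∈C , x∈A = bound A∈C x∈A

-- Zorn's lemma for inclusion, by the tower construction.

module Zorn
  (em : ∀ {a} → ExcludedMiddle a) (ext : ∀ {a b} → Extensionality a b)
  {ℓ g} {X : Set ℓ} (Good : Pred (Subset X) g) where

  open Comprehension em

  Chain : Subset (Subset X) → Set ℓ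
  Chain C = ∀ {A B} → ⟦ C ⟧ A → ⟦ C ⟧ B → A ⊆ B ⊎ B ⊆ A

  Improvable : Pred (Subset X) _
  Improvable A = ∃[ B ] Good B × A ⊆ B × ¬ (B ⊆ A)

  -- The extension that excluded middle returns is determined by `A`, so it serves as a choice
  -- function.
  step : Subset X → Subset X
  step A with em {P = Improvable A}
  ... | yes (B , _) = B
  ... | no  _       = A

  step-inflationary : ∀ {A} → A ⊆ step A
  step-inflationary {A} with em {P = Improvable A}
  ... | yes (_ , _ , A⊆B , _) = A⊆B
  ... | no  _                 = id

  step-good : ∀ {A} → Good A → Good (step A)
  step-good {A} good with em {P = Improvable A}
  ... | yes (_ , good′ , _) = good′
  ... | no  _               = good

  step-fixed⇒¬Improvable : ∀ {A} → step A ⊆ A → ¬ Improvable A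
  step-fixed⇒¬Improvable {A} stepA⊆A with em {P = Improvable A}
  ... | yes (_ , _ , _ , B⊈A) = ⊥-elim (B⊈A stepA⊆A)
  ... | no  ¬improvable       = ¬improvable

  data Tower : Pred (Subset X) ℓ where
    step-closed : ∀ {A} → Tower A → Tower (step A)
    ⋃-closed    : ∀ C → (∀ {A} → ⟦ C ⟧ A → Tower A) → Tower (⋃ C)

  -- The extreme points of the Bourbaki-Witt argument.
  Extreme : Pred (Subset X) ℓ
  Extreme A = ∀ {B} → Tower B → B ⊆ A → ¬ (A ⊆ B) → step B ⊆ A

  -- The choice inside `step` looks at the subset itself, so mutual inclusion must first become
  -- equality by extensionality.
  step-cong : ∀ {A B} → A ⊆ B → B ⊆ A → step A ⊆ step B
  step-cong A⊆B B⊆A rewrite ⊆-antisym ext A⊆B B⊆A = id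

  -- Induction on the tower member `B`. After a step, a proper inclusion is handled by extremeness
  -- and equality by `step-cong`; at a union, either some member contains `step A` or all lie in
  -- `A`.
  extreme-comparable : ∀ {A B} → Extreme A → Tower B → B ⊆ A ⊎ step A ⊆ B
  extreme-comparable {A} extreme (step-closed {B} tB)
    with extreme-comparable extreme tB | em {P = A ⊆ B}
  ... | inj₂ stepA⊆B | _       = inj₂ (step-inflationary ∘ stepA⊆B)
  ... | inj₁ B⊆A     | no A⊈B  = inj₁ (extreme tB B⊆A A⊈B)
  ... | inj₁ B⊆A     | yes A⊆B = inj₂ (step-cong A⊆B B⊆A)
  extreme-comparable {A} extreme (⋃-closed C tC)
    with em {P = ∃[ B ] ⟦ C ⟧ B × step A ⊆ B}
  ... | yes (_ , B∈C , stepA⊆B) = inj₂ (⋃-upper B∈C ∘ stepA⊆B)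
  ... | no  none                = inj₁ (⋃-least below)
    where
    below : ∀ {B} → ⟦ C ⟧ B → B ⊆ A
    below B∈C with extreme-comparable extreme (tC B∈C)
    ... | inj₁ B⊆A     = B⊆A
    ... | inj₂ stepA⊆B = ⊥-elim (none (_ , B∈C , stepA⊆B))

  -- Induction on `A`: `B` is compared with an earlier member, already extreme. For a union, that
  -- member is one not contained in `B`.
  tower-extreme : ∀ {A} → Tower A → Extreme A
  tower-extreme (step-closed {A} tA) {B} tB B⊆stepA stepA⊈B
    with extreme-comparable (tower-extreme tA) tB | em {P = A ⊆ B}
  ... | inj₂ stepA⊆B | _       = ⊥-elim (stepA⊈B stepA⊆B)
  ... | inj₁ B⊆A     | yes A⊆B = step-cong B⊆A A⊆B
  ... | inj₁ B⊆A     | no A⊈B  = step-inflationary ∘ tower-extreme tA tB B⊆A A⊈B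
  tower-extreme (⋃-closed C tC) {B} tB B⊆⋃ ⋃⊈B
    with em {P = ∃[ A ] ⟦ C ⟧ A × ¬ (A ⊆ B)}
  ... | no none = ⊥-elim (⋃⊈B (⋃-least all-below))
    where
    all-below : ∀ {A} → ⟦ C ⟧ A → A ⊆ B
    all-below {A} A∈C with em {P = A ⊆ B}
    ... | yes A⊆B = A⊆B
    ... | no  A⊈B = ⊥-elim (none (_ , A∈C , A⊈B))
  ... | yes (A , A∈C , A⊈B)
    with extreme-comparable (tower-extreme (tC A∈C)) tB
  ...   | inj₁ B⊆A     = ⋃-upper A∈C ∘ tower-extreme (tC A∈C) tB B⊆A A⊈B
  ...   | inj₂ stepA⊆B = ⊥-elim (A⊈B (stepA⊆B ∘ step-inflationary))

  tower-comparable : ∀ {A B} → Tower A → Tower B → A ⊆ B ⊎ B ⊆ A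
  tower-comparable tA tB with extreme-comparable (tower-extreme tA) tB
  ... | inj₁ B⊆A     = inj₂ B⊆A
  ... | inj₂ stepA⊆B = inj₁ (stepA⊆B ∘ step-inflationary)

  module _ (⋃-good : ∀ C → Chain C → (∀ {A} → ⟦ C ⟧ A → Good A) → Good (⋃ C)) where

    tower-good : ∀ {A} → Tower A → Good A
    tower-good (step-closed tA)  = step-good (tower-good tA)
    tower-good (⋃-closed C tC) =
      ⋃-good C (λ A∈C B∈C → tower-comparable (tC A∈C) (tC B∈C)) (λ A∈C → tower-good (tC A∈C))

    -- The union `M` of the tower belongs to the tower, hence so does `step M`, which therefore lies
    -- in `M`: nothing is left to improve.
    maximal : ∃[ M ] Good M × (∀ {B} → Good B → M ⊆ B → B ⊆ M)
    maximal = M , tower-good tower , λ {B} good M⊆B → maximality good M⊆B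
      where
      M = ⋃ (comprehension Tower)

      tower : Tower M
      tower = ⋃-closed _ (comprehension⁻)

      maximality : ∀ {B} → Good B → M ⊆ B → B ⊆ M
      maximality {B} good M⊆B with em {P = B ⊆ M}
      ... | yes B⊆M = B⊆M
      ... | no  B⊈M = ⊥-elim (step-fixed⇒¬Improvable {M} step⊆M (B , good , M⊆B , B⊈M))
        where
        step⊆M : step M ⊆ M
        step⊆M = ⋃-upper (comprehension⁺ (step-closed tower))

>>=-just⁻ : ∀ {a b} {A : Set a} {B : Set b} (m : Maybe A) {f : A → Maybe B} {y} →
            (m >>= f) ≡ just y → ∃[ x ] m ≡ just x × f x ≡ just y
>>=-just⁻ (just x) eq = x , refl , eq

≡just⇒Is-just : ∀ {a} {A : Set a} {m : Maybe A} {x} → m ≡ just x → Is-just m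
≡just⇒Is-just refl = Maybe.just tt

-- Elementary theory of effect algebras.

module EffectAlgebraProperties {ℓ} (E : EffectAlgebra ℓ) where
  open EffectAlgebra E
  open EffectAlgebraTheory E

  private variable
    a b c d e r s t v x y z : Carrier

  ⊕-comm⁺ : x ⊕ y ≡ just z → y ⊕ x ≡ just z
  ⊕-comm⁺ {x} {y} eq = trans (⊕-comm y x) eq

  ⊕-assocʳ : x ⊕ y ≡ just s → s ⊕ z ≡ just r →
             ∃[ t ] y ⊕ z ≡ just t × x ⊕ t ≡ just r
  ⊕-assocʳ {x} {y} {s} {z} xy sz = >>=-just⁻ (y ⊕ z) (trans (sym (⊕-assoc x y z))
    (trans (cong (_>>= (_⊕ z)) xy) sz))

  ⊕-assocˡ : y ⊕ z ≡ just t → x ⊕ t ≡ just r →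
             ∃[ s ] x ⊕ y ≡ just s × s ⊕ z ≡ just r
  ⊕-assocˡ {y} {z} {t} {x} yz xt = >>=-just⁻ (x ⊕ y) (trans (⊕-assoc x y z)
    (trans (cong (_>>= (x ⊕_)) yz) xt))

  ⊕-inverseʳ : ∀ x → x ⊕ x ′ ≡ just 𝟙
  ⊕-inverseʳ x = proj₁ (proj₂ (ortho x))

  ′-unique : x ⊕ y ≡ just 𝟙 → x ′ ≡ y
  ′-unique {x} = proj₂ (proj₂ (ortho x))

  ′-involutive : ∀ x → x ′ ′ ≡ x
  ′-involutive x = ′-unique (⊕-comm⁺ (⊕-inverseʳ x))

  -- The axiom on `𝟙` makes `𝟙 ′` equal to `𝟘`, so `x ′ ⊕ (x ⊕ 𝟘)` is `𝟙` and `x ⊕ 𝟘` is `x ′ ′`.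
  ⊕-identityʳ : ∀ x → x ⊕ 𝟘 ≡ just x
  ⊕-identityʳ x with ⊕-assocʳ (⊕-comm⁺ (⊕-inverseʳ x))
    (subst (λ w → 𝟙 ⊕ w ≡ just 𝟙) (𝟙⊕-zero _ (≡just⇒Is-just (⊕-inverseʳ 𝟙))) (⊕-inverseʳ 𝟙))
  ... | t , x𝟘 , x′t = trans x𝟘 (cong just (trans (sym (′-unique x′t)) (′-involutive x)))

  ⊕-identityˡ : ∀ x → 𝟘 ⊕ x ≡ just x
  ⊕-identityˡ x = ⊕-comm⁺ (⊕-identityʳ x)

  -- Both `y` and `v` are the orthosupplement of `x ⊕ z ′`.
  ⊕-cancelˡ : x ⊕ y ≡ just z → x ⊕ v ≡ just z → y ≡ v
  ⊕-cancelˡ {z = z} xy xv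
    with ⊕-assocʳ (⊕-comm⁺ xy) (⊕-inverseʳ z) | ⊕-assocʳ (⊕-comm⁺ xv) (⊕-inverseʳ z)
  ... | t , xz′ , yt | t₂ , xz′₂ , vt₂
    with refl ← just-injective (trans (sym xz′) xz′₂)
    = trans (sym (′-unique (⊕-comm⁺ yt))) (′-unique (⊕-comm⁺ vt₂))

  -- `𝟙 ⊕ (x ⊕ y)` is defined, hence so is `𝟙 ⊕ x`, which forces `x` to be `𝟘`.
  ⊕-positiveʳ : x ⊕ y ≡ just 𝟘 → y ≡ 𝟘
  ⊕-positiveʳ xy with ⊕-assocˡ xy (⊕-identityʳ 𝟙)
  ... | s , 𝟙x , sy with refl ← 𝟙⊕-zero _ (≡just⇒Is-just 𝟙x) =
    just-injective (trans (sym (⊕-identityˡ _)) xy)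

  ≤-refl : x ≤ x
  ≤-refl = 𝟘 , ⊕-identityʳ _

  ≤-trans : x ≤ y → y ≤ z → x ≤ z
  ≤-trans (_ , xa) (_ , yb) with ⊕-assocʳ xa yb
  ... | c , _ , xc = c , xc

  ≤-antisym : x ≤ y → y ≤ x → x ≡ y
  ≤-antisym {x} (a , xa) (b , yb) with ⊕-assocʳ xa yb
  ... | c , ab , xc with refl ← ⊕-cancelˡ xc (⊕-identityʳ x)
    with refl ← ⊕-positiveʳ (⊕-comm⁺ ab) = just-injective (trans (sym (⊕-identityʳ x)) xa)

  𝟘≤ : 𝟘 ≤ x
  𝟘≤ = _ , ⊕-identityˡ _

  ≤𝟘⇒≡𝟘 : x ≤ 𝟘 → x ≡ 𝟘
  ≤𝟘⇒≡𝟘 x≤𝟘 = ≤-antisym x≤𝟘 𝟘≤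

  summandˡ-≤ : x ⊕ y ≡ just z → x ≤ z
  summandˡ-≤ xy = _ , xy

  summandʳ-≤ : x ⊕ y ≡ just z → y ≤ z
  summandʳ-≤ xy = _ , ⊕-comm⁺ xy

  ⊕-monoˡ : a ≤ b → b ⊕ c ≡ just r → ∃[ s ] a ⊕ c ≡ just s × s ≤ r
  ⊕-monoˡ (_ , ad) bc with ⊕-assocʳ (⊕-comm⁺ ad) bc
  ... | s , ac , ds = s , ac , summandʳ-≤ ds

  ⊕-monoʳ : a ≤ b → c ⊕ b ≡ just r → ∃[ s ] c ⊕ a ≡ just s × s ≤ r
  ⊕-monoʳ a≤b cb with ⊕-monoˡ a≤b (⊕-comm⁺ cb)
  ... | s , ac , s≤r = s , ⊕-comm⁺ ac , s≤r

  -- With its converse below, this reduces definedness of sums to the order. Here `y ′` is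
  -- `x ⊕ z ′`.
  ≤′⁺ : x ⊕ y ≡ just z → x ≤ y ′
  ≤′⁺ {z = z} xy with ⊕-assocʳ (⊕-comm⁺ xy) (⊕-inverseʳ z)
  ... | t , xt , yt = subst (_ ≤_) (sym (′-unique yt)) (summandˡ-≤ xt)

  ≤′⁻ : x ≤ y ′ → ∃[ z ] x ⊕ y ≡ just z
  ≤′⁻ {y = y} x≤y′ with ⊕-monoˡ x≤y′ (⊕-comm⁺ (⊕-inverseʳ y))
  ... | z , xy , _ = z , xy

  ′-antitone : x ≤ y → y ′ ≤ x ′
  ′-antitone {y = y} x≤y with ⊕-monoˡ x≤y (⊕-inverseʳ y)
  ... | _ , xy′ , _ = ≤′⁺ (⊕-comm⁺ xy′)

  -- Sharp elements.

  sharp-′ : Sharp x → Sharp (x ′)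
  sharp-′ {x} (_ , sharp) = (𝟘≤ , 𝟘≤) , λ z (z≤x′ , z≤x″) →
    sharp z (subst (z ≤_) (′-involutive x) z≤x″ , z≤x′)

  sharp-′⁻ : Sharp (x ′) → Sharp x
  sharp-′⁻ {x} = subst Sharp (′-involutive x) ∘ sharp-′

  -- Orthosupplements reverse the order and preserve sharpness, so the smallest sharp element above
  -- `x ′` yields the greatest one below `x`.
  greatestSharpBelow : SharplyDominating → ∀ x → ∃[ t ] IsGreatestSharpBelow x t
  greatestSharpBelow dominating x with dominating (x ′)
  ... | c , (sharp , x′≤c) , smallest =
    c ′ , (sharp-′ sharp , subst (c ′ ≤_) (′-involutive x) (′-antitone x′≤c))
        , λ z (sharp-z , z≤x) → subst (_≤ c ′) (′-involutive z)
            (′-antitone (smallest (z ′) (sharp-′ sharp-z , ′-antitone z≤x)))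

  -- With m the smallest sharp element above d, also m ≤ e and m ⊕ b is defined;
  -- if m = d ⊕ g, then g ≤ m ≤ e and e ⊕ g = m ⊕ b, so g ≤ e ∧ e′ = 0.
  sharp-difference : SharplyDominating → Sharp b → Sharp e → b ⊕ d ≡ just e → Sharp d
  sharp-difference {d = d} dominating sharp-b sharp-e bd with dominating d
  ... | m , (sharp-m , (g , dg)) , smallest
    with ≤′⁻ (smallest _ (sharp-′ sharp-b , ≤′⁺ (⊕-comm⁺ bd)))
  ... | q , mb with ⊕-assocʳ (⊕-comm⁺ dg) mb
  ... | e₂ , db , ge = subst Sharp m≡d sharp-m
    where
    e₂≡e : e₂ ≡ _
    e₂≡e = just-injective (trans (sym (⊕-comm⁺ db)) bd)

    g≡𝟘 : g ≡ 𝟘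
    g≡𝟘 = ≤𝟘⇒≡𝟘 (proj₂ sharp-e g
      ( ≤-trans (summandʳ-≤ dg) (smallest _ (sharp-e , summandʳ-≤ bd))
      , subst (λ w → g ≤ w ′) e₂≡e (≤′⁺ ge)))

    m≡d : m ≡ d
    m≡d = just-injective (trans (sym dg)
      (subst (λ w → d ⊕ w ≡ just d) (sym g≡𝟘) (⊕-identityʳ d)))

  -- From `(a ⊕ b) ⊕ r ′ = 𝟙` follows `b ⊕ r ′ = a ′`, so `r ′` is a difference of sharp elements.
  sharp-⊕ : SharplyDominating → Sharp a → Sharp b → a ⊕ b ≡ just r → Sharp r
  sharp-⊕ {a} {r = r} dominating sharp-a sharp-b ab with ⊕-assocʳ ab (⊕-inverseʳ r)
  ... | t , br′ , at with refl ← ′-unique at =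
    sharp-′⁻ (sharp-difference dominating sharp-b (sharp-′ sharp-a) br′)

  -- Meager and hypermeager elements.

  Meager : Pred Carrier ℓ
  Meager x = ∀ {z} → Sharp z → z ≤ x → z ≡ 𝟘

  meager-≤ : x ≤ y → Meager y → Meager x
  meager-≤ x≤y meager sharp z≤x = meager sharp (≤-trans z≤x x≤y)

  -- For sharp `z ≤ y`, the sum `t ⊕ z` is sharp and below `x`, so it equals `t`, and `z` vanishes
  -- by cancellation.
  meager-difference : SharplyDominating → IsGreatestSharpBelow x t → t ⊕ y ≡ just x → Meager y
  meager-difference {t = t} dominating ((sharp-t , _) , greatest) ty sharp-z z≤y
    with ⊕-monoʳ z≤y ty
  ... | r , tz , r≤x = ⊕-cancelˡ (trans tz (cong just r≡t)) (⊕-identityʳ t)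
    where
    r≡t : r ≡ t
    r≡t = ≤-antisym (greatest r (sharp-⊕ dominating sharp-t sharp-z tz , r≤x)) (summandˡ-≤ tz)

  -- Otherwise `x ∧ x ′ = 𝟘`, since a common lower bound is hypermeager by way of `x` itself; then
  -- `x` is sharp, hence `𝟘` by meagerness.
  meager⇒hypermeager-below : (∀ {a} → ExcludedMiddle a) → Meager x → x ≢ 𝟘 →
                             ∃[ h ] Hypermeager h × h ≢ 𝟘 × h ≤ x
  meager⇒hypermeager-below {x} em meager x≢𝟘
    with em {P = ∃[ h ] Hypermeager h × h ≢ 𝟘 × h ≤ x}
  ... | yes found = found
  ... | no  none  = contradiction (meager ((𝟘≤ , 𝟘≤) , below) ≤-refl) x≢𝟘
    where
    below : ∀ h → h ≤ x × h ≤ x ′ → h ≤ 𝟘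
    below h (h≤x , h≤x′) with em {P = h ≡ 𝟘}
    ... | yes refl = ≤-refl
    ... | no  h≢𝟘  = contradiction (h , (x , h≤x , h≤x′) , h≢𝟘 , h≤x) none

  -- Finite sums.

  ⨁-swap : ∀ x y m → ((m >>= (y ⊕_)) >>= (x ⊕_)) ≡ ((m >>= (x ⊕_)) >>= (y ⊕_))
  ⨁-swap x y (just s) = trans (sym (⊕-assoc x y s))
    (trans (cong (_>>= (_⊕ s)) (⊕-comm x y)) (⊕-assoc y x s))
  ⨁-swap x y Maybe.nothing = refl

  ⨁-↭ : ∀ {K L} → K ↭ L → ⨁ K ≡ ⨁ L
  ⨁-↭ refl                   = refl
  ⨁-↭ (prep x K↭L)           = cong (_>>= (x ⊕_)) (⨁-↭ K↭L)
  ⨁-↭ (swap {xs = K} x y K↭L) = trans (⨁-swap x y (⨁ K))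
    (cong (λ m → (m >>= (x ⊕_)) >>= (y ⊕_)) (⨁-↭ K↭L))
  ⨁-↭ (K↭L ⟨↭⟩ L↭M)          = trans (⨁-↭ K↭L) (⨁-↭ L↭M)

  ⨁-∷⁺ : ∀ {K} → ⨁ K ≡ just s → x ⊕ s ≡ just r → ⨁ (x ∷ K) ≡ just r
  ⨁-∷⁺ {x = x} Ks xs = trans (cong (_>>= (x ⊕_)) Ks) xs

  ⨁-++⁺ : ∀ K {L} → ⨁ K ≡ just s → ⨁ L ≡ just t → s ⊕ t ≡ just r → ⨁ (K ++ L) ≡ just r
  ⨁-++⁺ [] refl Lt st = trans Lt (trans (sym (⊕-identityˡ _)) st)
  ⨁-++⁺ (x ∷ K) {L} Ks Lt st with >>=-just⁻ (⨁ K) Ks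
  ... | _ , K₁ , xs₁ with ⊕-assocʳ xs₁ st
  ... | _ , s₁t , xq = ⨁-∷⁺ {K = K ++ L} (⨁-++⁺ K K₁ Lt s₁t) xq

  ⨁-++⁻ˡ : ∀ K {L} → ⨁ (K ++ L) ≡ just r → ∃[ s ] ⨁ K ≡ just s × s ≤ r
  ⨁-++⁻ˡ []      _  = 𝟘 , refl , 𝟘≤
  ⨁-++⁻ˡ (x ∷ K) {L} eq with >>=-just⁻ (⨁ (K ++ L)) eq
  ... | q , KL , xq with ⨁-++⁻ˡ K KL
  ... | s , Ks , s≤q with ⊕-monoʳ s≤q xq
  ... | r , xs , r≤ = r , ⨁-∷⁺ {K = K} Ks xs , r≤

-- Lists and a bounded search.

tabulate-const : ∀ {a} {A : Set a} n (x : A) → tabulate {n = n} (λ _ → x) ≡ replicate n x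
tabulate-const zero    x = refl
tabulate-const (suc n) x = cong (x ∷_) (tabulate-const n x)

-- Later entries of `xs` differ from its head, so they survive its removal from `ys`.
unique-⊆⇒↭ : ∀ {a} {A : Set a} {xs ys : List A} → Unique xs →
             (∀ {x} → x ∈ xs → x ∈ ys) → ∃[ zs ] ys ↭ xs ++ zs
unique-⊆⇒↭ [] _ = _ , refl
unique-⊆⇒↭ {xs = x ∷ xs} (x∉xs ∷ unique) xs⊆ys with ∈-∃++ (xs⊆ys (here refl))
... | ys₁ , ys₂ , refl with unique-⊆⇒↭ unique rest
  where
  rest : ∀ {z} → z ∈ xs → z ∈ ys₁ ++ ys₂
  rest z∈xs with ∈-resp-↭ (shift x ys₁ ys₂) (xs⊆ys (there z∈xs))
  ... | here refl = contradiction refl (All.lookup x∉xs z∈xs)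
  ... | there z∈  = z∈
... | zs , ys₁₂↭ = zs , shift x ys₁ ys₂ ⟨↭⟩ prep x ys₁₂↭

-- Used to find the largest multiple that still has room.
last-before-bound : (∀ {a} → ExcludedMiddle a) → ∀ {p} (P : Pred ℕ p) N →
                    (∀ {n} → P n → n ℕ.≤ N) → P 0 → ∃[ n ] P n × ¬ P (suc n)
last-before-bound em P N bound P0 = search (suc N) 0 (ℕ.m≤m+n _ 0) P0
  where
  -- `k` is fuel: by `N < k + n`, once it is spent `n` exceeds the bound `N`.
  search : ∀ k n → N ℕ.< k ℕ.+ n → P n → ∃[ n ] P n × ¬ P (suc n)
  search zero    n N<n  Pn = contradiction (bound Pn) (ℕ.<⇒≱ N<n)
  search (suc k) n N<kn Pn with em {P = P (suc n)}
  ... | yes Psn = search k (suc n) (subst (N ℕ.<_) (sym (ℕ.+-suc k n)) N<kn) Psn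
  ... | no ¬Psn = n , Pn , ¬Psn

-- Saturated sets of multiples of hypermeager elements.

module SaturatedSets
  (em : ∀ {a} → ExcludedMiddle a) (ext : ∀ {a b} → Extensionality a b)
  {ℓ} (E : EffectAlgebra ℓ) (y : EffectAlgebra.Carrier E) where

  open EffectAlgebra E
  open EffectAlgebraTheory E
  open EffectAlgebraProperties E
  open Comprehension em

  private variable
    a b h r s : Carrier
    A B : Subset Carrier

  Sums : Subset Carrier → Pred Carrier ℓ
  Sums A = SetFiniteSums ⟦ A ⟧

  -- A subset cannot repeat an element, so `n` copies of `h` are represented by the single element
  -- that is their sum.
  HypermeagerMultiple : Pred Carrier ℓ
  HypermeagerMultiple a = ∃[ n ] ∃[ h ] Hypermeager h × multiple n h ≡ just a

  Bounded : Pred (Subset Carrier) ℓ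
  Bounded A = ∀ K → Unique K → All ⟦ A ⟧ K → ∃[ s ] ⨁ K ≡ just s × s ≤ y

  -- If `b` already lies in `A`, this asks for a further copy of it.
  Room : Subset Carrier → Pred Carrier ℓ
  Room A b = ∀ {s} → Sums A s → ∃[ r ] b ⊕ s ≡ just r × r ≤ y

  -- The last condition makes a new element with room differ from all members, so
  -- that repetitions, which (W+) does not cover, never arise.
  Good : Pred (Subset Carrier) ℓ
  Good A = (∀ {a} → ⟦ A ⟧ a → HypermeagerMultiple a)
         × Bounded A
         × (∀ {a} → ⟦ A ⟧ a → ¬ Room A a)

  open Zorn em ext Good using (Chain; Improvable; maximal)

  𝟘∈Sums : Sums A 𝟘
  𝟘∈Sums = [] , [] , [] , refl

  Sums-mono : A ⊆ B → Sums A s → Sums B s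
  Sums-mono A⊆B (K , unique , K⊆A , sum) = K , unique , All.map A⊆B K⊆A , sum

  Room-antitone : A ⊆ B → Room B b → Room A b
  Room-antitone A⊆B room s∈ = room (Sums-mono A⊆B s∈)

  -- Of two members of a chain the larger serves. The list has a first entry because an empty family
  -- `C` offers no member.
  chain-finite : ∀ {C} → Chain C → ∀ a K → All ⟦ ⋃ C ⟧ (a ∷ K) →
                 ∃[ A ] ⟦ C ⟧ A × All ⟦ A ⟧ (a ∷ K)
  chain-finite chain a [] (a∈⋃ ∷ []) with comprehension⁻ a∈⋃
  ... | A , A∈C , a∈A = A , A∈C , a∈A ∷ []
  chain-finite chain a (b ∷ K) (a∈⋃ ∷ K⊆⋃)
    with comprehension⁻ a∈⋃ | chain-finite chain b K K⊆⋃
  ... | A , A∈C , a∈A | B , B∈C , K⊆B with chain A∈C B∈C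
  ... | inj₁ A⊆B = B , B∈C , A⊆B a∈A ∷ K⊆B
  ... | inj₂ B⊆A = A , A∈C , a∈A ∷ All.map B⊆A K⊆B

  -- Bounds concern finite lists, and a nonempty one lies in a single member; room in the union
  -- would be room in each member.
  ⋃-good : ∀ C → Chain C → (∀ {A} → ⟦ C ⟧ A → Good A) → Good (⋃ C)
  ⋃-good C chain good = multiples , bounded , no-room
    where
    multiples : ∀ {a} → ⟦ ⋃ C ⟧ a → HypermeagerMultiple a
    multiples a∈⋃ with comprehension⁻ a∈⋃
    ... | _ , A∈C , a∈A = proj₁ (good A∈C) a∈A

    bounded : Bounded (⋃ C)
    bounded []      _      _   = 𝟘 , refl , 𝟘≤
    bounded (a ∷ K) unique K⊆⋃ with chain-finite chain a K K⊆⋃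
    ... | _ , A∈C , K⊆A = proj₁ (proj₂ (good A∈C)) (a ∷ K) unique K⊆A

    no-room : ∀ {a} → ⟦ ⋃ C ⟧ a → ¬ Room (⋃ C) a
    no-room a∈⋃ room with comprehension⁻ a∈⋃
    ... | _ , A∈C , a∈A = proj₂ (proj₂ (good A∈C)) a∈A (Room-antitone (⋃-upper A∈C) room)

  insert : Carrier → Subset Carrier → Subset Carrier
  insert b A = comprehension λ a → ⟦ A ⟧ a ⊎ a ≡ b

  ⊆-insert : A ⊆ insert b A
  ⊆-insert = comprehension⁺ ∘ inj₁

  ∈-insert : ⟦ insert b A ⟧ b
  ∈-insert = comprehension⁺ (inj₂ refl)

  insert-≢ : ⟦ insert b A ⟧ a → b ≢ a → ⟦ A ⟧ a
  insert-≢ a∈ b≢a with comprehension⁻ a∈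
  ... | inj₁ a∈A  = a∈A
  ... | inj₂ refl = contradiction refl b≢a

  -- A duplicate-free list contains `b` at most once; moved to the front, it is added to a sum of
  -- elements of `A`.
  insert-bounded : Bounded A → Room A b → Bounded (insert b A)
  insert-bounded {A} {b} bounded room K unique K⊆ with em {P = b ∈ K}
  ... | no b∉K = bounded K unique
    (All.tabulate λ a∈K → insert-≢ (All.lookup K⊆ a∈K) λ { refl → b∉K a∈K })
  ... | yes b∈K with ∈-∃++ b∈K
  ... | K₁ , K₂ , refl
    with σ ← shift b K₁ K₂
    with b∉ ∷ unique′ ← Permutationₛ.Unique-resp-↭ (setoid Carrier) (↭⇒↭ₛ σ) unique
       | _ ∷ K′⊆ ← All-resp-↭ σ K⊆
    with K′⊆A ← All.zipWith (uncurry insert-≢) (K′⊆ , b∉)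
    with bounded (K₁ ++ K₂) unique′ K′⊆A
  ... | s , sum , _ with room (K₁ ++ K₂ , unique′ , K′⊆A , sum)
  ... | r , bs , r≤y = r , trans (⨁-↭ σ) (⨁-∷⁺ {K = K₁ ++ K₂} sum bs) , r≤y

  Sums-insert : ¬ ⟦ A ⟧ b → Sums A s → b ⊕ s ≡ just r → Sums (insert b A) r
  Sums-insert {A} {b} b∉A (K , unique , K⊆A , sum) bs =
    b ∷ K , All.map (λ a∈A b≡a → b∉A (subst ⟦ A ⟧ (sym b≡a) a∈A)) K⊆A ∷ unique
          , ∈-insert ∷ All.map ⊆-insert K⊆A , ⨁-∷⁺ {K = K} sum bs

  -- The new element `b` is the largest multiple of `h` with room, so it is not in `A`. Room for a
  -- second `b` would give room in `A` for `h ⊕ b`, against the choice of `b`.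
  room⇒improvable : Archimedean → Good A → Hypermeager h → h ≢ 𝟘 → Room A h →
                    Improvable A
  room⇒improvable {A} {h} archimedean (multiples , bounded , no-room) hypermeager h≢𝟘 room
    with archimedean h h≢𝟘
  ... | N , _ , _ , bound
    with last-before-bound em P N
           -- `P n` concerns `suc n` copies, so the Archimedean bound `N` covers `n` as well, and
           -- `n = 0` stands for `h` itself.
           (λ (_ , eq , _) → ℕ.≤-trans (ℕ.n≤1+n _) (bound _ (≡just⇒Is-just eq)))
           (h , ⊕-identityʳ h , room)
    where
    P : Pred ℕ ℓ
    P n = ∃[ b ] multiple (suc n) h ≡ just b × Room A b
  ... | n , (b , nh≡b , room-b) , last
    = insert b A
    , (multiples′ , insert-bounded bounded room-b , no-room′)
    , ⊆-insert , λ insert⊆A → b∉A (insert⊆A ∈-insert)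
    where
    b∉A : ¬ ⟦ A ⟧ b
    b∉A b∈A = no-room b∈A room-b

    multiples′ : ∀ {a} → ⟦ insert b A ⟧ a → HypermeagerMultiple a
    multiples′ a∈ with comprehension⁻ a∈
    ... | inj₁ a∈A  = multiples a∈A
    ... | inj₂ refl = suc n , h , hypermeager , nh≡b

    h≤b : h ≤ b
    h≤b with >>=-just⁻ (multiple n h) nh≡b
    ... | _ , _ , eq = summandˡ-≤ eq

    -- As `b` is not in `A`, `b ⊕ s` is a sum of the enlarged set, so `b ⊕ (b ⊕ s)` stays within
    -- `y`. Replace the outer `b` by `h ≤ b` and reassociate.
    one-more : Room (insert b A) b → ∀ {s} → Sums A s →
               ∃[ c ] h ⊕ b ≡ just c × ∃[ r ] c ⊕ s ≡ just r × r ≤ y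
    one-more room-b₂ s∈ with room-b s∈
    ... | q , bs , _ with room-b₂ (Sums-insert b∉A s∈ bs)
    ... | _ , bq , bq≤y with ⊕-monoˡ h≤b bq
    ... | r , hq , r≤bq with ⊕-assocˡ bs hq
    ... | c , hb , cs = c , hb , r , cs , ≤-trans r≤bq bq≤y

    no-room-twice : ¬ Room (insert b A) b
    -- The empty sum already yields `h ⊕ b`, before any `s` is given.
    no-room-twice room-b₂ with one-more room-b₂ 𝟘∈Sums
    ... | c , hb , _ = last (c , ⨁-∷⁺ {K = replicate (suc n) h} nh≡b hb , room-c)
      where
      room-c : Room A c
      room-c s∈ with one-more room-b₂ s∈
      ... | c₂ , hb₂ , sum with refl ← just-injective (trans (sym hb) hb₂) = sum

    no-room′ : ∀ {a} → ⟦ insert b A ⟧ a → ¬ Room (insert b A) a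
    no-room′ a∈ with comprehension⁻ a∈
    ... | inj₁ a∈A  = no-room a∈A ∘ Room-antitone ⊆-insert
    ... | inj₂ refl = no-room-twice

  saturated : Archimedean → ∃[ A ] Good A × (∀ {h} → Hypermeager h → h ≢ 𝟘 → ¬ Room A h)
  saturated archimedean with maximal ⋃-good
  ... | A , good , maximality = A , good , λ hypermeager h≢𝟘 room →
    let B , good′ , A⊆B , B⊈A = room⇒improvable archimedean good hypermeager h≢𝟘 room
    in B⊈A (maximality good′ A⊆B)

  -- `W+` supplies an upper bound `w` below `u` and `y`. A hypermeager `h` below a nonzero
  -- difference of `y` and `w` would have room: every sum `s` lies below `w`, so
  -- `h ⊕ s ≤ h ⊕ w ≤ y`.
  saturated⇒least : W+ → Meager y → Bounded A →
                    (∀ {h} → Hypermeager h → h ≢ 𝟘 → ¬ Room A h) →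
                    ∀ {u} → UpperBound (Sums A) u → y ≤ u
  saturated⇒least {A} w+ meager bounded full {u} upper-u
    with w+ ⟦ A ⟧ orthogonal u y upper-u upper-y
    where
    orthogonal : OrthogonalSet ⟦ A ⟧
    orthogonal K unique K⊆A = ≡just⇒Is-just (proj₁ (proj₂ (bounded K unique K⊆A)))

    upper-y : UpperBound (Sums A) y
    upper-y s (K , unique , K⊆A , sum) with bounded K unique K⊆A
    ... | _ , sum′ , s≤y with refl ← just-injective (trans (sym sum) sum′) = s≤y
  ... | w , upper-w , w≤u , (z , wz) with em {P = z ≡ 𝟘}
  ... | yes refl = subst (_≤ u) (just-injective (trans (sym (⊕-identityʳ w)) wz)) w≤u
  ... | no  z≢𝟘 with meager⇒hypermeager-below em (meager-≤ (summandʳ-≤ wz) meager) z≢𝟘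
  ... | h , hypermeager , h≢𝟘 , h≤z = ⊥-elim (full hypermeager h≢𝟘 room)
    where
    room : Room A h
    room {s} s∈ with ⊕-monoˡ h≤z (⊕-comm⁺ wz)
    ... | _ , hw , hw≤y with ⊕-monoʳ (upper-w s s∈) hw
    ... | r , hs , r≤hw = r , hs , ≤-trans r≤hw hw≤y

  -- Splitting the multiples into a system of hypermeager elements.

  module System {A : Subset Carrier} (multiples : ∀ {a} → ⟦ A ⟧ a → HypermeagerMultiple a) where

    _≟_ : DecidableEquality Carrier
    _ ≟ _ = em

    -- Defined for every `a`, so that an index carries no membership proof; the last component
    -- recovers membership from any index over `a`.
    decompose : ∀ a → ∃[ n ] ∃[ h ] Hypermeager h
                × (⟦ A ⟧ a → multiple n h ≡ just a) × (Fin n → ⟦ A ⟧ a)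
    decompose a with em {P = ⟦ A ⟧ a}
    -- Outside `A` there are no copies; the filler `𝟘` is never indexed.
    ... | no  a∉A = 0 , 𝟘 , (𝟘 , 𝟘≤ , 𝟘≤) , (λ a∈A → contradiction a∈A a∉A) , λ ()
    ... | yes a∈A with multiples a∈A
    ... | n , h , hypermeager , eq = n , h , hypermeager , (λ _ → eq) , λ _ → a∈A

    multiplicity : Carrier → ℕ
    multiplicity a = proj₁ (decompose a)

    Index : Set ℓ
    Index = Σ[ a ∈ Carrier ] Fin (multiplicity a)

    system : Index → Carrier
    system (a , _) = proj₁ (proj₂ (decompose a))

    system-hypermeager : ∀ κ → Hypermeager (system κ)
    system-hypermeager (a , _) = proj₁ (proj₂ (proj₂ (decompose a)))

    block : Carrier → List Index
    block a = tabulate (a ,_)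

    ⨁-block : ⟦ A ⟧ a → ⨁ (map system (block a)) ≡ just a
    ⨁-block {a} a∈A = trans
      (cong ⨁ (trans (map-tabulate (a ,_) system) (tabulate-const (multiplicity a) _)))
      (proj₁ (proj₂ (proj₂ (proj₂ (decompose a)))) a∈A)

    ⨁-blocks : ∀ L → All ⟦ A ⟧ L → ⨁ L ≡ just s → ⨁ (map system (concatMap block L)) ≡ just s
    ⨁-blocks []      _           eq = eq
    ⨁-blocks (a ∷ L) (a∈A ∷ L⊆A) eq with >>=-just⁻ (⨁ L) eq
    ... | _ , sum , as = trans (cong ⨁ (map-++ system (block a) (concatMap block L)))
      (⨁-++⁺ (map system (block a)) (⨁-block a∈A) (⨁-blocks L L⊆A sum) as)

    blocks-unique : ∀ {L} → Unique L → Unique (concatMap block L)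
    blocks-unique {L} unique = Unique.concat⁺
      (All.map⁺ (All.universal (λ a → Unique.tabulate⁺ λ { refl → refl }) L))
      (AllPairs.map⁺ (AllPairs.map disjoint unique))
      where
      disjoint : ∀ {a b} → a ≢ b → Disjoint (block a) (block b)
      disjoint a≢b (κ∈a , κ∈b) with ∈-tabulate⁻ κ∈a | ∈-tabulate⁻ κ∈b
      ... | _ , refl | _ , eq = a≢b (cong proj₁ eq)

    -- Turns an upper bound for the system into one for `A`, to which `W+` applies.
    Sums⇒FiniteSums : Sums A s → FiniteSums system s
    Sums⇒FiniteSums (L , unique , L⊆A , sum) =
      concatMap block L , blocks-unique unique , ⨁-blocks L L⊆A sum

    support : List Index → List Carrier
    support K = deduplicate _≟_ (map proj₁ K)

    support-⊆ : ∀ K → All ⟦ A ⟧ (support K)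
    support-⊆ K = All.deduplicate⁺ _≟_ (All.map⁺ (All.universal
      (λ (a , i) → proj₂ (proj₂ (proj₂ (proj₂ (decompose a)))) i) K))

    ∈-blocks-support : ∀ {κ} K → κ ∈ K → κ ∈ concatMap block (support K)
    ∈-blocks-support {_ , i} K κ∈K = ∈-concatMap⁺ block
      (Any.map (λ { refl → ∈-tabulate⁺ i }) (∈-deduplicate⁺ _≟_ (∈-map⁺ proj₁ κ∈K)))

    -- The indices in `K` form part of the full blocks over their support, whose sum is a finite sum
    -- of `A` and so below `y`; a partial sum exists and is no larger.
    system-bounded : Bounded A → ∀ K → Unique K → ∃[ s ] ⨁ (map system K) ≡ just s × s ≤ y
    system-bounded bounded K unique
      with t , sum , t≤y ← bounded (support K) (DecUnique.deduplicate-! _≟_ _) (support-⊆ K)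
      with R , σ ← unique-⊆⇒↭ unique (∈-blocks-support K)
      with s , sum′ , s≤t ← ⨁-++⁻ˡ (map system K) (trans
             (trans (cong ⨁ (sym (map-++ system K R))) (sym (⨁-↭ (↭-map⁺ system σ))))
             (⨁-blocks (support K) (support-⊆ K) sum))
      = s , sum′ , ≤-trans s≤t t≤y

  meager⇒orthosum : Archimedean → W+ → Meager y →
    Σ[ H ∈ Set ℓ ] Σ[ g ∈ (H → Carrier) ]
      Orthogonal g × (∀ κ → Hypermeager (g κ)) × IsOrthosum g y
  meager⇒orthosum archimedean w+ meager with saturated archimedean
  ... | A , (multiples , bounded , _) , full =
    Index , system , orthogonal , system-hypermeager , upper , least
    where
    open System multiples

    orthogonal : Orthogonal system
    orthogonal K unique = ≡just⇒Is-just (proj₁ (proj₂ (system-bounded bounded K unique)))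

    upper : UpperBound (FiniteSums system) y
    upper s (K , unique , sum) with system-bounded bounded K unique
    ... | _ , sum′ , s≤y = subst (_≤ y) (just-injective (trans (sym sum′) sum)) s≤y

    least : ∀ u → UpperBound (FiniteSums system) u → y ≤ u
    least u upper-u = saturated⇒least w+ meager bounded full
      λ s s∈ → upper-u s (Sums⇒FiniteSums s∈)

corollary3p5 : (∀ {a : Level} → ExcludedMiddle a) →
    (∀ {a b : Level} → Extensionality a b) →
    ∀ {ℓ : Level} (E : EffectAlgebra ℓ) →
    let open EffectAlgebra E
        open EffectAlgebraTheory E in
    Archimedean → SharplyDominating → W+ →
    ∀ (x : Carrier) →
    ∃[ t ] IsGreatestSharpBelow x t ×
    (Σ[ H ∈ Set ℓ ] Σ[ g ∈ (H → Carrier) ]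
      Orthogonal g ×
      (∀ κ → Hypermeager (g κ)) ×
      (∃[ s ] IsOrthosum g s × t ⊕ s ≡ just x))
corollary3p5 em ext E archimedean dominating w+ x =
  let open EffectAlgebraProperties E
      t , t-greatest@((_ , (y , ty)) , _) = greatestSharpBelow dominating x
      H , g , orthogonal , hypermeager , orthosum =
        SaturatedSets.meager⇒orthosum em ext E y archimedean w+
          (meager-difference dominating t-greatest ty)
  in t , t-greatest , H , g , orthogonal , hypermeager , y , orthosum , ty
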